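{- Let $m,n\geq 3$, let $C_m^-$ and $C_n^-$ be two unbalanced signed cycles on $m$ and $n$ vertices respectively, and let $C_m^-\Box C_n^-$ be their Cartesian product. Then $$\operatorname{bdim}(C_m^-\Box C_n^-)=\begin{cases}2, & \text{if } m,n>3,\\ 3, & \text{otherwise}.\end{cases}$$
   Context: A signed graph $\Sigma=(G,\sigma)$ is a graph $G=(V,E)$ with a function $\sigma:E\to\{+1,-1\}$. The sign of a cycle is the product of the signs of its edges; $\Sigma$ is balanced if it has no cycle of sign $-1$. An unbalanced signed cycle $C_m^-$ is a signed graph whose underlying graph is the cycle on $m$ vertices and whose product of edge signs is $-1$. Let $\Omega=\{ -1,0,1\}$, with $\Omega^k\subset\mathbb{R}^k$ carrying the standard inner product $\langle\cdot,\cdot\rangle$. A vector valued switching function ($k$-switching function) for $\Sigma$ is a map $\zeta:V\to\Omega^k$ with $\langle\zeta(u),\zeta(v)\rangle\neq 0$ for every edge $uv\in E$; the switched signed graph $\Sigma^\zeta=(G,\sigma^\zeta)$ has $\sigma^\zeta(uv)=\sigma(uv)\operatorname{sgn}(\langle\zeta(u),\zeta(v)\rangle)$. The balancing dimension $\operatorname{bdim}(\Sigma)$ is the least integer $k\ge 1$ for which there is a $k$-switching function $\zeta:V\to\Omega^k$ such that $\Sigma^\zeta$ is all-positive (every edge has sign $+1$). The Cartesian product $\Sigma_1\Box\Sigma_2$ of $\Sigma_1=(G_1,\sigma_1)$ and $\Sigma_2=(G_2,\sigma_2)$ is the Cartesian product $G_1\Box G_2$ of the underlying graphs, with signature $\sigma((u_i,v_j)(u_k,v_l))=\sigma_1(u_iu_k)$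 if $j=l$, and $=\sigma_2(v_jv_l)$ if $i=k$. -}

module Defs where

open import Algebra.Properties.CommutativeMonoid.Sum as CMSum using ()
open import Data.Fin.Base using (Fin; toℕ)
open import Data.Fin.Properties using (toℕ<n; toℕ-fromℕ<)
open import Data.Integer.Base as ℤ using (ℤ; 0ℤ; 1ℤ; -1ℤ; sign)
import Data.Integer.Properties as ℤ
open import Data.Nat.Base using (ℕ; zero; suc; s≤s; z≤n; _≤_; _%_)
open import Data.Nat.DivMod using (_mod_; m<n⇒m%n≡m; n%n≡0; m%n<n)
open import Data.Nat.Properties using (m≤n⇒m<n∨m≡n; suc-injective; 1+n≢n)
open import Data.Product.Base using (Σ; _×_; _,_; proj₁; ∃-syntax)
open import Data.Sign.Base as Sign using (Sign)
import Data.Sign.Properties as Sign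
open import Data.Sum.Base using (_⊎_; inj₁; inj₂; swap)
open import Data.Vec.Functional using (Vector)
open import Relation.Binary.PropositionalEquality
  using (_≡_; _≢_; refl; sym; trans; cong; cong₂; subst)
open import Relation.Nullary.Negation.Core using (¬_; contradiction)

open CMSum ℤ.+-0-commutativeMonoid using (sum; sum-cong-≗)
open CMSum Sign.*-commutativeMonoid using () renaming (sum to product)

record Graph : Set₁ where
  infix 4 _~_
  field
    V        : Set
    _~_      : V → V → Set
    ~-sym    : ∀ {u v} → u ~ v → v ~ u
    ~-irrefl : ∀ {v} → ¬ (v ~ v)

-- A sign for each undirected edge: `sign-sym` and `sign-irr` say that the sign
-- depends neither on the orientation of the edge nor on the adjacency proof.
record Signature (G : Graph) : Set where
  open Graph G
  field
    edgeSign : ∀ {u v} → u ~ v → Sign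
    sign-sym : ∀ {u v} (e : u ~ v) → edgeSign (~-sym e) ≡ edgeSign e
    sign-irr : ∀ {u v} (e e′ : u ~ v) → edgeSign e ≡ edgeSign e′

SignedGraph : Set₁
SignedGraph = Σ Graph Signature

AllPositive : SignedGraph → Set
AllPositive (G , σ) = ∀ {u v} (e : u ~ v) → edgeSign e ≡ Sign.+
  where open Graph G; open Signature σ

next : ∀ {m} → Fin m → Fin m
next {suc m} i = suc (toℕ i) mod suc m

next-≢ : ∀ {m} → 3 ≤ m → (i : Fin m) → i ≢ next i
next-≢ {suc m} (s≤s (s≤s _)) i i≡next with m≤n⇒m<n∨m≡n (toℕ<n i)
... | inj₁ 1+i<m = 1+n≢n (sym (trans i≡1+i% (m<n⇒m%n≡m 1+i<m)))
  where
  i≡1+i% : toℕ i ≡ suc (toℕ i) % suc m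
  i≡1+i% = trans (cong toℕ i≡next) (toℕ-fromℕ< (m%n<n (suc (toℕ i)) (suc m)))
... | inj₂ 1+i≡m = contradiction (trans (sym (suc-injective 1+i≡m)) i≡0) λ ()
  where
  i≡0 : toℕ i ≡ 0
  i≡0 = trans (cong toℕ i≡next)
       (trans (toℕ-fromℕ< (m%n<n (suc (toℕ i)) (suc m)))
       (trans (cong (_% suc m) 1+i≡m) (n%n≡0 (suc m))))

cycle : (m : ℕ) → 3 ≤ m → Graph
cycle m m≥3 = record
  { V        = Fin m
  ; _~_      = λ i j → j ≡ next i ⊎ i ≡ next j
  ; ~-sym    = swap
  ; ~-irrefl = λ { (inj₁ p) → next-≢ m≥3 _ p ; (inj₂ p) → next-≢ m≥3 _ p }
  }

-- `product` is the stdlib's `sum` over the multiplicative monoid of signs; as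
-- m ≥ 3, the edges {i, next i} for i : Fin m list each edge of the cycle once.
cycleSign : ∀ {m} {m≥3 : 3 ≤ m} → Signature (cycle m m≥3) → Sign
cycleSign σ = product (λ i → edgeSign {i} {next i} (inj₁ refl))
  where open Signature σ

Unbalanced : ∀ {m} {m≥3 : 3 ≤ m} → Signature (cycle m m≥3) → Set
Unbalanced {m} {m≥3} σ = cycleSign {m} {m≥3} σ ≡ Sign.-

infixr 7 _□ᴳ_ _□_

_□ᴳ_ : Graph → Graph → Graph
G □ᴳ H = record
  { V        = G.V × H.V
  ; _~_      = λ (u , v) (u′ , v′) → (u G.~ u′ × v ≡ v′) ⊎ (u ≡ u′ × v H.~ v′)
  ; ~-sym    = λ { (inj₁ (e , p)) → inj₁ (G.~-sym e , sym p)
                 ; (inj₂ (p , e)) → inj₂ (sym p , H.~-sym e) }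
  ; ~-irrefl = λ { (inj₁ (e , _)) → G.~-irrefl e
                 ; (inj₂ (_ , e)) → H.~-irrefl e }
  }
  where module G = Graph G; module H = Graph H

_□_ : SignedGraph → SignedGraph → SignedGraph
(G , σ) □ (H , τ) = G □ᴳ H , record
  { edgeSign = λ { (inj₁ (e , _)) → σ.edgeSign e
                 ; (inj₂ (_ , e)) → τ.edgeSign e }
  ; sign-sym = λ { (inj₁ (e , _)) → σ.sign-sym e
                 ; (inj₂ (_ , e)) → τ.sign-sym e }
  ; sign-irr = λ { (inj₁ (e , _)) (inj₁ (e′ , _)) → σ.sign-irr e e′
                 ; (inj₁ (e , _)) (inj₂ (refl , _)) → contradiction e G.~-irrefl
                 ; (inj₂ (refl , _)) (inj₁ (e , _)) → contradiction e G.~-irrefl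
                 ; (inj₂ (_ , e)) (inj₂ (_ , e′)) → τ.sign-irr e e′ }
  }
  where
  module G = Graph G
  module σ = Signature σ
  module τ = Signature τ

data Ω : Set where
  -1Ω 0Ω 1Ω : Ω

⟦_⟧ : Ω → ℤ
⟦ -1Ω ⟧ = -1ℤ
⟦ 0Ω  ⟧ = 0ℤ
⟦ 1Ω  ⟧ = 1ℤ

-- The standard inner product of ℝᵏ takes integer values on Ωᵏ.
⟨_,_⟩ : ∀ {k} → Vector Ω k → Vector Ω k → ℤ
⟨ x , y ⟩ = sum (λ i → ⟦ x i ⟧ ℤ.* ⟦ y i ⟧)

⟨⟩-comm : ∀ {k} (x y : Vector Ω k) → ⟨ x , y ⟩ ≡ ⟨ y , x ⟩
⟨⟩-comm x y = sum-cong-≗ λ i → ℤ.*-comm ⟦ x i ⟧ ⟦ y i ⟧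

record SwitchingFunction (k : ℕ) (Γ : SignedGraph) : Set where
  open Graph (proj₁ Γ)
  field
    ζ       : V → Vector Ω k
    nonzero : ∀ {u v} → u ~ v → ⟨ ζ u , ζ v ⟩ ≢ 0ℤ

-- `sign 0ℤ` is `+` in the stdlib, but `nonzero` excludes that case.
switch : ∀ {k} (Γ : SignedGraph) → SwitchingFunction k Γ → SignedGraph
switch (G , σ) f = G , record
  { edgeSign = λ {u} {v} e → edgeSign e Sign.* sign ⟨ ζ u , ζ v ⟩
  ; sign-sym = λ {u} {v} e →
      cong₂ Sign._*_ (sign-sym e) (cong sign (⟨⟩-comm (ζ v) (ζ u)))
  ; sign-irr = λ {u} {v} e e′ →
      cong (Sign._* sign ⟨ ζ u , ζ v ⟩) (sign-irr e e′)
  }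
  where
  open Signature σ
  open SwitchingFunction f

Balanceable : SignedGraph → ℕ → Set
Balanceable Γ k = ∃[ f ] AllPositive (switch {k} Γ f)

-- bdim Γ = d, where bdim Γ is the least k ≥ 1 such that `Balanceable Γ k`;
-- a relation, so that no existence proof for general Γ is needed to define it.
record BDim (Γ : SignedGraph) (d : ℕ) : Set where
  field
    positive  : 1 ≤ d
    balancing : Balanceable Γ d
    least     : ∀ k → 1 ≤ k → Balanceable Γ k → d ≤ k

{-# OPTIONS --safe #-}
-- Upper bounds: take 2h vectors of Ωᵏ (an octagon for h = 4, k = 2; the hexagon of
-- roots of A₂ for h = 3, k = 3), indexed periodically by angles p, such that vec p
-- has positive inner product with vec p and vec (p + 1), and negative inner product
-- with vec (p + h) and vec (p + h + 1), for every p.  On an unbalanced cycle of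
-- length at least h choose angles A advancing by 1 along h of the edges and by an
-- extra half turn h along each negative edge: as the number of negative edges is odd,
-- the total advance h + h · #negative is a multiple of 2h, so A is well defined.  As
-- the conditions on vec hold at every angle p, the function
-- ζ (i , j) = vec (A i + B j) balances the product of two such cycles.
--
-- Lower bounds: balancing functions restrict to the layers of the product; for k = 1
-- the sign of a cycle telescopes to +, and for k = 2 a triangle is always positive,
-- since two of any three pairwise non-orthogonal lines spanned by vectors of Ω²
-- coincide.
module Submission where

open import Defs
open import Algebra.Properties.CommutativeMonoid.Sum as CMSum using ()
open import Data.Bool.Base using (if_then_else_)
open import Data.Fin.Base using (Fin; zero; suc; toℕ; fromℕ; inject₁)
open import Data.Fin.Patterns using (0F; 1F; 2F)
import Data.Fin.Properties as Fin
open import Data.Fin.Relation.Unary.Top using (view; ‵fromℕ; ‵inject₁)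
open import Data.Integer.Base as ℤ using (ℤ; 0ℤ; sign)
import Data.Integer.Properties as ℤ
open import Data.Nat.Base using (ℕ; zero; suc; _+_; _*_; _≤_; _<_; _%_; z≤n; s≤s; NonZero)
open import Data.Nat.DivMod
  using (_mod_; m<n⇒m%n≡m; n%n≡0; [m+n]%n≡m%n; %-distribˡ-+; m%n%n≡m%n)
open import Data.Nat.Properties
  using (_<?_; +-0-commutativeMonoid; +-assoc; +-comm; +-identityʳ; ≤-antisym; ≮⇒≥)
open import Data.Nat.Tactic.RingSolver using (solve-∀)
open import Data.Product.Base using (_×_; _,_; proj₁; proj₂; ∃-syntax)
open import Data.Sign.Base as Sign using (Sign)
import Data.Sign.Properties as Sign
open import Data.Sum.Base using (inj₁; inj₂)
open import Data.Vec.Functional using (Vector; []; _∷_)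
open import Function.Base using (_∘_)
open import Relation.Binary.PropositionalEquality
open import Relation.Nullary.Decidable
  using (Dec; yes; no; does; _×-dec_; _→-dec_; ¬?; map′; from-yes)
open import Relation.Nullary.Negation.Core using (¬_; contradiction)

open CMSum +-0-commutativeMonoid using (sum; ∑-distrib-+; sum-replicate-zero)
open CMSum Sign.*-commutativeMonoid using () renaming
  ( sum to product; sum-cong-≗ to product-cong
  ; ∑-distrib-+ to product-distrib-*; sum-init-last to product-init-last )

open ≡-Reasoning

-- Cyclic successor, edge conditions and finite decisions

next-inject₁ : ∀ {m} (i : Fin m) → next (inject₁ i) ≡ suc i
next-inject₁ {m} i = Fin.toℕ-injective (begin
  toℕ (next (inject₁ i))        ≡⟨ Fin.toℕ-fromℕ< _ ⟩
  suc (toℕ (inject₁ i)) % suc m ≡⟨ cong (λ x → suc x % suc m) (Fin.toℕ-inject₁ i) ⟩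
  suc (toℕ i) % suc m           ≡⟨ m<n⇒m%n≡m (s≤s (Fin.toℕ<n i)) ⟩
  suc (toℕ i)                   ∎)

next-fromℕ : ∀ m → next (fromℕ m) ≡ zero
next-fromℕ m = Fin.toℕ-injective (begin
  toℕ (next (fromℕ m))        ≡⟨ Fin.toℕ-fromℕ< _ ⟩
  suc (toℕ (fromℕ m)) % suc m ≡⟨ cong (λ x → suc x % suc m) (Fin.toℕ-fromℕ m) ⟩
  suc m % suc m               ≡⟨ n%n≡0 (suc m) ⟩
  0                           ∎)

-- Both demands on an edge of sign `s` whose end vectors have inner product `z`. As `sign 0ℤ` is
-- `+`, the second does not imply the first.
record Agrees (s : Sign) (z : ℤ) : Set where
  constructor agrees
  field
    nonzero  : z ≢ 0ℤ
    positive : s Sign.* sign z ≡ Sign.+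

open Agrees

agrees? : ∀ s z → Dec (Agrees s z)
agrees? s z = map′ (λ (p , q) → agrees p q) (λ (agrees p q) → p , q)
  (¬? (z ℤ.≟ 0ℤ) ×-dec (s Sign.* sign z Sign.≟ Sign.+))

agrees⇒≡ : ∀ {s z} → Agrees s z → s ≡ sign z
agrees⇒≡ {s} {z} a =
  Sign.*-cancelʳ-≡ (sign z) s (sign z) (trans (positive a) (sym (Sign.s*s≡+ (sign z))))

allSign? : ∀ {P : Sign → Set} → (∀ s → Dec (P s)) → Dec (∀ s → P s)
allSign? P? = map′ (λ { (p , q) Sign.+ → p ; (p , q) Sign.- → q })
  (λ f → f Sign.+ , f Sign.-) (P? Sign.+ ×-dec P? Sign.-)

allΩ? : ∀ {P : Ω → Set} → (∀ x → Dec (P x)) → Dec (∀ x → P x)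
allΩ? P? = map′ (λ { (p , q , r) -1Ω → p ; (p , q , r) 0Ω → q ; (p , q , r) 1Ω → r })
  (λ f → f -1Ω , f 0Ω , f 1Ω) (P? -1Ω ×-dec P? 0Ω ×-dec P? 1Ω)

-- Angles on a cycle

partialSum : ∀ {m} → Vector ℕ m → Vector ℕ m
partialSum f zero    = 0
partialSum f (suc i) = f zero + partialSum (f ∘ suc) i

partialSum-suc : ∀ {m} (f : Vector ℕ (suc m)) (i : Fin m) →
  partialSum f (inject₁ i) + f (inject₁ i) ≡ partialSum f (suc i)
partialSum-suc f zero    = sym (+-identityʳ (f zero))
partialSum-suc f (suc i) =
  trans (+-assoc (f zero) _ _) (cong (f zero +_) (partialSum-suc (f ∘ suc) i))

partialSum-last : ∀ {m} (f : Vector ℕ (suc m)) →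
  partialSum f (fromℕ m) + f (fromℕ m) ≡ sum f
partialSum-last {zero}  f = sym (+-identityʳ (f zero))
partialSum-last {suc m} f =
  trans (+-assoc (f zero) _ _) (cong (f zero +_) (partialSum-last (f ∘ suc)))

-- Only the last edge wraps around: there the full sum, a multiple of `d`, drops to the initial 0.
-- Every other edge just adds its term, with quotient 0.
partialSum-next : ∀ {m} d (f : Vector ℕ m) → ∃[ q ] sum f ≡ q * d →
  ∀ i → ∃[ q ] partialSum f i + f i ≡ q * d + partialSum f (next i)
partialSum-next {suc m} d f (q , ∑f≡qd) i with view i
... | ‵fromℕ = q , (begin
  partialSum f (fromℕ m) + f (fromℕ m)        ≡⟨ partialSum-last f ⟩
  sum f                                       ≡⟨ ∑f≡qd ⟩
  q * d                                       ≡⟨ +-identityʳ (q * d) ⟨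
  q * d + 0                                   ≡⟨ cong (λ j → q * d + partialSum f j) (next-fromℕ m) ⟨
  q * d + partialSum f (next (fromℕ m))       ∎)
... | ‵inject₁ j = 0 ,
  trans (partialSum-suc f j) (cong (partialSum f) (sym (next-inject₁ j)))

-- Values in `Fin 2` rather than `ℕ` keep the unit steps within reach of the finite check
-- `rotates?`.
firsts : ∀ {m} → ℕ → Vector (Fin 2) m
firsts zero    _       = 0F
firsts (suc h) zero    = 1F
firsts (suc h) (suc i) = firsts h i

sum-firsts : ∀ {h m} → h ≤ m → sum {m} (toℕ ∘ firsts h) ≡ h
sum-firsts {m = m} z≤n = sum-replicate-zero m
sum-firsts (s≤s h≤m)   = cong suc (sum-firsts h≤m)

halfTurn : ℕ → Sign → ℕ
halfTurn h Sign.+ = 0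
halfTurn h Sign.- = h

-- A parity count: `product s` is `-` exactly when the number of negative signs is odd, and the
-- extra half turn then makes the number of half turns even.
sum-halfTurn : ∀ h {m} (s : Vector Sign m) →
  ∃[ q ] halfTurn h (product s) + sum (halfTurn h ∘ s) ≡ q * (2 * h)
sum-halfTurn h {zero}  s = 0 , refl
sum-halfTurn h {suc m} s
  with s zero | product (s ∘ suc) | sum-halfTurn h (s ∘ suc)
... | Sign.+ | _      | ih     = ih
... | Sign.- | Sign.- | ih     = ih
-- The half turn of the new negative sign and the correction for the now negative product make one
-- full turn.
... | Sign.- | Sign.+ | q , eq = suc q , trans (lemma h _) (cong (2 * h +_) eq)
  where
  lemma : ∀ h x → h + (h + x) ≡ 2 * h + x
  lemma = solve-∀

advance : ℕ → Fin 2 → Sign → ℕ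
advance h b s = toℕ b + halfTurn h s

-- Angles are plain natural numbers, with `q` recording the full turns dropped at an edge, so that
-- angles on two cycles can be added without reducing them.
record Angles (h : ℕ) {m : ℕ} (s : Vector Sign m) : Set where
  field
    angle    : Vector ℕ m
    advances : ∀ i → ∃[ b ] ∃[ q ]
      angle i + advance h b (s i) ≡ q * (2 * h) + angle (next i)

angles : ∀ {h m} → h ≤ m → (s : Vector Sign m) → product s ≡ Sign.- → Angles h s
angles {h} {m} h≤m s ∏s≡- = record
  { angle    = partialSum f
  ; advances = λ i → firsts h i , partialSum-next (2 * h) f total i
  }
  where
  f : Vector ℕ m
  f i = advance h (firsts h i) (s i)

  total : ∃[ q ] sum f ≡ q * (2 * h)
  total with sum-halfTurn h s
  ... | q , eq = q , (begin
    sum f                                              ≡⟨ ∑-distrib-+ (toℕ ∘ firsts {m} h) (halfTurn h ∘ s) ⟩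
    sum (toℕ ∘ firsts {m} h) + sum (halfTurn h ∘ s)    ≡⟨ cong (_+ sum (halfTurn h ∘ s)) (sum-firsts h≤m) ⟩
    -- As the product is `-`, the `h` unit advances serve as the correction term of `sum-halfTurn`.
    h + sum (halfTurn h ∘ s)                           ≡⟨ cong (λ t → halfTurn h t + sum (halfTurn h ∘ s)) ∏s≡- ⟨
    halfTurn h (product s) + sum (halfTurn h ∘ s)      ≡⟨ eq ⟩
    q * (2 * h)                                        ∎)

-- Polygons in Ωᵏ

record Polygon (h k : ℕ) : Set where
  field
    vec      : ℕ → Vector Ω k
    periodic : ∀ p → vec (2 * h + p) ≡ vec p
    rotate   : ∀ p b s → Agrees s ⟨ vec p , vec (p + advance h b s) ⟩

  periodic* : ∀ q p → vec (q * (2 * h) + p) ≡ vec p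
  periodic* zero    p = refl
  periodic* (suc q) p =
    trans (cong vec (+-assoc (2 * h) (q * (2 * h)) p)) (trans (periodic _) (periodic* q p))

mod-cong : ∀ {a b} d .{{_ : NonZero d}} → a % d ≡ b % d → a mod d ≡ b mod d
mod-cong d eq = Fin.fromℕ<-cong _ _ eq _ _

toℕ-mod-+ : ∀ d .{{_ : NonZero d}} p a → (toℕ (p mod d) + a) mod d ≡ (p + a) mod d
toℕ-mod-+ d p a = mod-cong d (begin
  (toℕ (p mod d) + a) % d         ≡⟨ cong (λ x → (x + a) % d) (Fin.toℕ-fromℕ< _) ⟩
  (p % d + a) % d                 ≡⟨ %-distribˡ-+ (p % d) a d ⟩
  (p % d % d + a % d) % d         ≡⟨ cong (λ x → (x + a % d) % d) (m%n%n≡m%n p d) ⟩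
  (p % d + a % d) % d             ≡⟨ %-distribˡ-+ p a d ⟨
  (p + a) % d                     ∎)

module _ {h k : ℕ} .{{_ : NonZero (2 * h)}} (vertex : Vector (Vector Ω k) (2 * h)) where

  -- One period of `Polygon.rotate`, hence decidable; `toℕ-mod-+` carries it to every angle.
  Rotates : Set
  Rotates = ∀ p b s → Agrees s ⟨ vertex p , vertex ((toℕ p + advance h b s) mod (2 * h)) ⟩

  rotates? : Dec Rotates
  rotates? = Fin.all? λ p → Fin.all? λ b → allSign? λ s → agrees? s _

  polygon : Rotates → Polygon h k
  polygon rotates = record
    { vec      = λ p → vertex (p mod (2 * h))
    ; periodic = λ p → cong vertex (mod-cong (2 * h)
        (trans (cong (_% (2 * h)) (+-comm (2 * h) p)) ([m+n]%n≡m%n p (2 * h))))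
    ; rotate   = λ p b s → subst (λ x → Agrees s ⟨ vertex (p mod (2 * h)) , vertex x ⟩)
        (toℕ-mod-+ (2 * h) p (advance h b s)) (rotates (p mod (2 * h)) b s)
    }

-- Neighbours are 45 degrees apart, and vertex `p + 4` is the negative of vertex `p`.
octagon : Polygon 4 2
octagon = polygon {4} vertex (from-yes (rotates? {4} vertex))
  where
  vertex : Vector (Vector Ω 2) 8
  vertex = (1Ω  ∷ 0Ω  ∷ []) ∷ (1Ω  ∷ 1Ω  ∷ []) ∷ (0Ω ∷ 1Ω  ∷ []) ∷ (-1Ω ∷ 1Ω  ∷ [])
         ∷ (-1Ω ∷ 0Ω  ∷ []) ∷ (-1Ω ∷ -1Ω ∷ []) ∷ (0Ω ∷ -1Ω ∷ []) ∷ (1Ω  ∷ -1Ω ∷ []) ∷ []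

-- Neighbours are 60 degrees apart in the plane of coordinate sum 0, and a half turn takes only 3
-- steps, few enough for a triangle.
hexagon : Polygon 3 3
hexagon = polygon {3} vertex (from-yes (rotates? {3} vertex))
  where
  vertex : Vector (Vector Ω 3) 6
  vertex = (1Ω  ∷ -1Ω ∷ 0Ω ∷ []) ∷ (0Ω ∷ -1Ω ∷ 1Ω  ∷ []) ∷ (-1Ω ∷ 0Ω ∷ 1Ω  ∷ [])
         ∷ (-1Ω ∷ 1Ω  ∷ 0Ω ∷ []) ∷ (0Ω ∷ 1Ω  ∷ -1Ω ∷ []) ∷ (1Ω  ∷ 0Ω ∷ -1Ω ∷ []) ∷ []

-- Upper bounds

forwardSign : ∀ {m} {m≥3 : 3 ≤ m} → Signature (cycle m m≥3) → Vector Sign m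
forwardSign σ i = Signature.edgeSign σ {i} {next i} (inj₁ refl)

cycle-agrees : ∀ {m} {m≥3 : 3 ≤ m} (σ : Signature (cycle m m≥3)) {k} (ζ : Fin m → Vector Ω k) →
  (∀ i → Agrees (forwardSign {m} {m≥3} σ i) ⟨ ζ i , ζ (next i) ⟩) →
  ∀ {i j} (e : Graph._~_ (cycle m m≥3) i j) → Agrees (Signature.edgeSign σ e) ⟨ ζ i , ζ j ⟩
cycle-agrees σ ζ a {i} (inj₁ refl) = a i
cycle-agrees σ ζ a {_} {j} (inj₂ refl) =
  subst₂ Agrees (sym (Signature.sign-sym σ (inj₁ refl))) (⟨⟩-comm (ζ j) (ζ (next j))) (a j)

module _ {h k} (P : Polygon h k) where
  open Polygon P

  -- Here `c` is the angle contributed by the other factor, constant along a layer; it is harmless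
  -- because `rotate` holds from every starting angle.
  rotate-angles : ∀ {m} {s : Vector Sign m} (α : Angles h s) c i → let open Angles α in
    Agrees (s i) ⟨ vec (angle i + c) , vec (angle (next i) + c) ⟩
  rotate-angles {s = s} α c i with Angles.advances α i
  ... | b , q , eq = subst (λ x → Agrees (s i) ⟨ vec (A i + c) , x ⟩) vec≡ (rotate _ b (s i))
    where
    open Angles α renaming (angle to A)

    swapʳ : ∀ x y z → x + y + z ≡ x + z + y
    swapʳ = solve-∀

    vec≡ : vec (A i + c + advance h b (s i)) ≡ vec (A (next i) + c)
    vec≡ = begin
      vec (A i + c + advance h b (s i))       ≡⟨ cong vec (swapʳ (A i) c _) ⟩
      vec (A i + advance h b (s i) + c)       ≡⟨ cong (λ x → vec (x + c)) eq ⟩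
      vec (q * (2 * h) + A (next i) + c)      ≡⟨ cong vec (+-assoc (q * (2 * h)) _ c) ⟩
      vec (q * (2 * h) + (A (next i) + c))    ≡⟨ periodic* q _ ⟩
      vec (A (next i) + c)                    ∎

  polygon-balances : ∀ {m n} {m≥3 : 3 ≤ m} {n≥3 : 3 ≤ n}
    (σ : Signature (cycle m m≥3)) (τ : Signature (cycle n n≥3)) →
    Unbalanced {m} {m≥3} σ → Unbalanced {n} {n≥3} τ → h ≤ m → h ≤ n →
    Balanceable ((cycle m m≥3 , σ) □ (cycle n n≥3 , τ)) k
  polygon-balances {m} {n} {m≥3} {n≥3} σ τ uσ uτ h≤m h≤n =
    record { ζ = ζ ; nonzero = λ e → nonzero (ok e) } , λ e → positive (ok e)
    where
    Γ : SignedGraph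
    Γ = (cycle m m≥3 , σ) □ (cycle n n≥3 , τ)

    α : Angles h (forwardSign {m} {m≥3} σ)
    α = angles h≤m _ uσ

    β : Angles h (forwardSign {n} {n≥3} τ)
    β = angles h≤n _ uτ

    ζ : Fin m × Fin n → Vector Ω k
    ζ (i , j) = vec (Angles.angle α i + Angles.angle β j)

    rotate-β : ∀ i j → Agrees (forwardSign {n} {n≥3} τ j) ⟨ ζ (i , j) , ζ (i , next j) ⟩
    rotate-β i j = subst₂ (λ x y → Agrees (forwardSign {n} {n≥3} τ j) ⟨ vec x , vec y ⟩)
      (+-comm _ (Angles.angle α i)) (+-comm _ (Angles.angle α i)) (rotate-angles β (Angles.angle α i) j)

    ok : ∀ {u v} (e : Graph._~_ (proj₁ Γ) u v) →
      Agrees (Signature.edgeSign (proj₂ Γ) e) ⟨ ζ u , ζ v ⟩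
    ok {_ , j} (inj₁ (e , refl)) =
      cycle-agrees {m} {m≥3} σ (λ i → ζ (i , j)) (rotate-angles α (Angles.angle β j)) e
    ok {i , _} (inj₂ (refl , e)) =
      cycle-agrees {n} {n≥3} τ (λ j → ζ (i , j)) (rotate-β i) e

-- Lower bounds

module _ {Γ Δ : SignedGraph} {k : ℕ} where
  open Graph using (V)

  balanceable-□ˡ : V (proj₁ Δ) → Balanceable (Γ □ Δ) k → Balanceable Γ k
  balanceable-□ˡ v (f , pos) = record
    { ζ       = λ u → SwitchingFunction.ζ f (u , v)
    ; nonzero = λ e → SwitchingFunction.nonzero f (inj₁ (e , refl))
    } , λ e → pos (inj₁ (e , refl))

  balanceable-□ʳ : V (proj₁ Γ) → Balanceable (Γ □ Δ) k → Balanceable Δ k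
  balanceable-□ʳ u (f , pos) = record
    { ζ       = λ v → SwitchingFunction.ζ f (u , v)
    ; nonzero = λ e → SwitchingFunction.nonzero f (inj₂ (refl , e))
    } , λ e → pos (inj₂ (refl , e))

-- Shifting cyclically only moves the first factor to the end.
product-next : ∀ {m} (t : Vector Sign m) → product (t ∘ next) ≡ product t
product-next {zero}  t = refl
product-next {suc m} t = begin
  product (t ∘ next)                                           ≡⟨ product-init-last (t ∘ next) ⟩
  product (t ∘ next ∘ inject₁) Sign.* t (next (fromℕ m))
    ≡⟨ cong₂ Sign._*_ (product-cong (cong t ∘ next-inject₁)) (cong t (next-fromℕ m)) ⟩
  product (t ∘ suc) Sign.* t zero                              ≡⟨ Sign.*-comm (product (t ∘ suc)) (t zero) ⟩
  product t                                                    ∎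

-- Each vertex sign enters once for each of its two edges, so the product is a square.
switching-balanced : ∀ {m} (s t : Vector Sign m) →
  (∀ i → s i ≡ t i Sign.* t (next i)) → product s ≡ Sign.+
switching-balanced s t eq = begin
  product s                                  ≡⟨ product-cong eq ⟩
  product (λ i → t i Sign.* t (next i))      ≡⟨ product-distrib-* t (t ∘ next) ⟩
  product t Sign.* product (t ∘ next)        ≡⟨ cong (product t Sign.*_) (product-next t) ⟩
  product t Sign.* product t                 ≡⟨ Sign.s*s≡+ (product t) ⟩
  Sign.+                                     ∎

-- A nonzero product excludes the entry 0, for which multiplicativity of `sign` can fail, as with 0
-- and -1.
sign-⟨⟩₁ : ∀ (x y : Vector Ω 1) → ⟨ x , y ⟩ ≢ 0ℤ →
  sign ⟨ x , y ⟩ ≡ sign ⟦ x 0F ⟧ Sign.* sign ⟦ y 0F ⟧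
sign-⟨⟩₁ x y = from-yes (allΩ? λ a → allΩ? λ b →
  ¬? (⟨ a ∷ [] , b ∷ [] ⟩ ℤ.≟ 0ℤ) →-dec
  (sign ⟨ a ∷ [] , b ∷ [] ⟩ Sign.≟ sign ⟦ a ⟧ Sign.* sign ⟦ b ⟧)) (x 0F) (y 0F)

module _ {m} {m≥3 : 3 ≤ m} {σ : Signature (cycle m m≥3)} where
  open SwitchingFunction

  forwardSign≡ : ∀ {k} ((f , _) : Balanceable (cycle m m≥3 , σ) k) i →
    forwardSign {m} {m≥3} σ i ≡ sign ⟨ ζ f i , ζ f (next i) ⟩
  forwardSign≡ (f , pos) i = agrees⇒≡ (agrees (nonzero f (inj₁ refl)) (pos {i} (inj₁ refl)))

  unbalanced⇒¬1-balanceable : Unbalanced {m} {m≥3} σ → ¬ Balanceable (cycle m m≥3 , σ) 1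
  unbalanced⇒¬1-balanceable u bal@(f , _) =
    contradiction (trans (sym u) (switching-balanced _ (λ i → sign ⟦ ζ f i 0F ⟧) λ i →
      trans (forwardSign≡ bal i) (sign-⟨⟩₁ (ζ f i) (ζ f (next i)) (nonzero f (inj₁ refl)))))
      λ ()

-- The four lines form two orthogonal pairs, and each pair supplies at most one of the lines used.
-- If, say, `y` is `x` up to sign, that sign occurs in `⟨ x , y ⟩` and relates `⟨ y , z ⟩` to
-- `⟨ z , x ⟩`, so it cancels. The code checks all cases.
triangle-positive : ∀ (x y z : Vector Ω 2) →
  ⟨ x , y ⟩ ≢ 0ℤ → ⟨ y , z ⟩ ≢ 0ℤ → ⟨ z , x ⟩ ≢ 0ℤ →
  sign ⟨ x , y ⟩ Sign.* (sign ⟨ y , z ⟩ Sign.* (sign ⟨ z , x ⟩ Sign.* Sign.+)) ≡ Sign.+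
triangle-positive x y z = from-yes
  (allΩ? λ a → allΩ? λ b → allΩ? λ c → allΩ? λ d → allΩ? λ e → allΩ? λ f →
    let x = a ∷ b ∷ [] ; y = c ∷ d ∷ [] ; z = e ∷ f ∷ [] in
    ¬? (⟨ x , y ⟩ ℤ.≟ 0ℤ) →-dec ¬? (⟨ y , z ⟩ ℤ.≟ 0ℤ) →-dec ¬? (⟨ z , x ⟩ ℤ.≟ 0ℤ) →-dec
    (sign ⟨ x , y ⟩ Sign.* (sign ⟨ y , z ⟩ Sign.* (sign ⟨ z , x ⟩ Sign.* Sign.+)) Sign.≟ Sign.+))
  (x 0F) (x 1F) (y 0F) (y 1F) (z 0F) (z 1F)

unbalanced⇒¬2-balanceable : ∀ {m} {m≥3 : 3 ≤ m} {σ : Signature (cycle m m≥3)} → m ≡ 3 →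
  Unbalanced {m} {m≥3} σ → ¬ Balanceable (cycle m m≥3 , σ) 2
unbalanced⇒¬2-balanceable {m≥3 = m≥3} {σ} refl u bal@(f , _) = contradiction
  (begin
    Sign.-                                               ≡⟨ u ⟨
    product (forwardSign {3} {m≥3} σ)                    ≡⟨ product-cong (forwardSign≡ {m≥3 = m≥3} {σ} bal) ⟩
    -- `next 2F` computes to `0F`, and `product` over three indices unfolds to the nested form with
    -- a final `+`.
    product (λ i → sign ⟨ ζ f i , ζ f (next i) ⟩)        ≡⟨ triangle-positive (ζ f 0F) (ζ f 1F) (ζ f 2F) (edge 0F) (edge 1F) (edge 2F) ⟩
    Sign.+                                               ∎)
  λ ()
  where
  open SwitchingFunction

  edge : ∀ i → ⟨ ζ f i , ζ f (next i) ⟩ ≢ 0ℤ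
  edge i = nonzero f {i} (inj₁ refl)

-- Balancing dimension of the product

bdim-2 : ∀ {Γ} → Balanceable Γ 2 → ¬ Balanceable Γ 1 → BDim Γ 2
bdim-2 bal ¬bal₁ = record
  { positive = s≤s z≤n ; balancing = bal
  ; least = λ { 1 _ bal₁ → contradiction bal₁ ¬bal₁ ; (suc (suc _)) _ _ → s≤s (s≤s z≤n) } }

bdim-3 : ∀ {Γ} → Balanceable Γ 3 → ¬ Balanceable Γ 1 → ¬ Balanceable Γ 2 → BDim Γ 3
bdim-3 bal ¬bal₁ ¬bal₂ = record
  { positive = s≤s z≤n ; balancing = bal
  ; least = λ { 1 _ bal₁ → contradiction bal₁ ¬bal₁
              ; 2 _ bal₂ → contradiction bal₂ ¬bal₂
              ; (suc (suc (suc _))) _ _ → s≤s (s≤s (s≤s z≤n)) } }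

proposition2p5 : (m n : ℕ) (m≥3 : 3 ≤ m) (n≥3 : 3 ≤ n)
    (σ : Signature (cycle m m≥3)) (τ : Signature (cycle n n≥3)) →
    Unbalanced {m} {m≥3} σ → Unbalanced {n} {n≥3} τ →
    BDim ((cycle m m≥3 , σ) □ (cycle n n≥3 , τ))
    (if does ((3 <? m) ×-dec (3 <? n)) then 2 else 3)
-- Successor patterns supply the vertex `zero` through which the layers are taken.
proposition2p5 m@(suc _) n@(suc _) m≥3 n≥3 σ τ uσ uτ = byCases (3 <? m) (3 <? n)
  where
  Γ : SignedGraph
  Γ = (cycle m m≥3 , σ) □ (cycle n n≥3 , τ)

  left : ∀ {k} → Balanceable Γ k → Balanceable (cycle m m≥3 , σ) k
  left = balanceable-□ˡ {cycle m m≥3 , σ} {cycle n n≥3 , τ} zero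

  right : ∀ {k} → Balanceable Γ k → Balanceable (cycle n n≥3 , τ) k
  right = balanceable-□ʳ {cycle m m≥3 , σ} {cycle n n≥3 , τ} zero

  bal₃ : Balanceable Γ 3
  bal₃ = polygon-balances hexagon {m≥3 = m≥3} {n≥3} σ τ uσ uτ m≥3 n≥3

  ¬bal₁ : ¬ Balanceable Γ 1
  ¬bal₁ = unbalanced⇒¬1-balanceable {m≥3 = m≥3} {σ} uσ ∘ left

  -- Abstracting both decisions lets the `if` reduce in each case. `3 < m` unfolds to `4 ≤ m`, the
  -- length needed for the octagon.
  byCases : (m? : Dec (3 < m)) (n? : Dec (3 < n)) →
    BDim Γ (if does (m? ×-dec n?) then 2 else 3)
  byCases (yes m>3) (yes n>3) =
    bdim-2 (polygon-balances octagon {m≥3 = m≥3} {n≥3} σ τ uσ uτ m>3 n>3) ¬bal₁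
  byCases (yes _)   (no n≯3)  = bdim-3 bal₃ ¬bal₁
    (unbalanced⇒¬2-balanceable {m≥3 = n≥3} {τ} (≤-antisym (≮⇒≥ n≯3) n≥3) uτ ∘ right)
  byCases (no m≯3)  _         = bdim-3 bal₃ ¬bal₁
    (unbalanced⇒¬2-balanceable {m≥3 = m≥3} {σ} (≤-antisym (≮⇒≥ m≯3) m≥3) uσ ∘ left)
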